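{- Let $n\ge 1$ be an integer and let $K=\{123,132,213,231\}$. The number of equivalence classes of $S_n$ under $K$-equivalence is $n$.
   Context: Permutations in $S_n$ are written as words $\pi_1\pi_2\cdots\pi_n$ in one-line notation. The order permutation of a word $u$ of $c$ distinct positive integers is the unique $\sigma\in S_c$ with $\sigma_i<\sigma_j$ iff $u_i<u_j$. A replacement partition $K$ of $S_c$ is a set partition of $S_c$; it is denoted by listing its parts with the one-element parts (and outer brackets) omitted, so here $K$ is the set partition of $S_3$ whose only part of size greater than one is $\{123,132,213,231\}$. The $K$-equivalence on $S_n$ is the equivalence relation generated by: $\phi\equiv\psi$ whenever $\phi=aub$ and $\psi=avb$ (concatenations) for some possibly empty words $a,b$ and words $u,v$ of length $c$ (so $u,v$ occupy the same $c$ consecutive positions) such that the order permutations of $u$ and $v$ lie in the same part of $K$. All equivalence classes are counted, including one-element classes. -}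

module Defs where

open import Data.Fin using (Fin)
open import Data.List using (List; []; _∷_; _++_; applyUpTo)
open import Data.List.Membership.Propositional using (_∈_)
open import Data.List.Relation.Binary.Disjoint.Propositional using (Disjoint)
open import Data.List.Relation.Binary.Permutation.Propositional
  using (_↭_; refl; prep; swap; trans)
open import Data.List.Relation.Unary.AllPairs using (AllPairs; []; _∷_)
open import Data.List.Relation.Unary.All using ([])
open import Data.List.Relation.Unary.Any using (Any)
open import Data.Nat using (ℕ; suc; _<_)
open import Data.Product using (_×_; ∃-syntax)
open import Data.Sum using (_⊎_)
open import Data.Vec using (Vec; []; _∷_; lookup; toList)
open import Function.Bundles using (_⇔_; Inverse)
open import Level using (0ℓ)
open import Relation.Binary.Bundles using (Setoid)
open import Relation.Binary.Core using (Rel)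
open import Relation.Binary.PropositionalEquality as ≡ using (_≡_)
import Relation.Binary.Construct.Closure.Equivalence as EqClosure

-- One-line notation with letters 1, …, n.  The field `isPermutation` is
-- irrelevant, so two permutations with the same word are equal.
record Permutation (n : ℕ) : Set where
  constructor mkPerm
  field
    word           : Vec ℕ n
    .isPermutation : toList word ↭ applyUpTo suc n

open Permutation public

IsOrderPermutation : ∀ {c} → Vec ℕ c → Permutation c → Set
IsOrderPermutation u σ =
  ∀ i j → lookup (word σ) i < lookup (word σ) j ⇔ lookup u i < lookup u j

-- A set partition of S_c.  Every permutation absent from all the listed
-- parts forms a one-element part.
record ReplacementPartition (c : ℕ) : Set where
  field
    parts    : List (List (Permutation c))
    disjoint : AllPairs Disjoint parts

open ReplacementPartition public

SamePart : ∀ {c} → ReplacementPartition c → Rel (Permutation c) 0ℓ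
SamePart K σ τ = σ ≡ τ ⊎ Any (λ P → σ ∈ P × τ ∈ P) (parts K)

Replacement : ∀ {c} → ReplacementPartition c → ∀ n → Rel (Permutation n) 0ℓ
Replacement {c} K n φ ψ =
  ∃[ a ] ∃[ b ] ∃[ u ] ∃[ v ] ∃[ σ ] ∃[ τ ]
    toList (word φ) ≡ a ++ toList {n = c} u ++ b ×
    toList (word ψ) ≡ a ++ toList {n = c} v ++ b ×
    IsOrderPermutation u σ ×
    IsOrderPermutation v τ ×
    SamePart K σ τ

-- S_n with the equivalence relation generated by replacements.
K-equivalence : ∀ {c} → ReplacementPartition c → ℕ → Setoid 0ℓ 0ℓ
K-equivalence K n = EqClosure.setoid (Replacement K n)

-- The quotient of S by its equivalence has exactly k elements.
HasNumberOfClasses : Setoid 0ℓ 0ℓ → ℕ → Set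
HasNumberOfClasses S k = Inverse S (≡.setoid (Fin k))

p123 p132 p213 p231 : Permutation 3
p123 = mkPerm (1 ∷ 2 ∷ 3 ∷ []) refl
p132 = mkPerm (1 ∷ 3 ∷ 2 ∷ []) (prep 1 (swap 3 2 refl))
p213 = mkPerm (2 ∷ 1 ∷ 3 ∷ []) (swap 2 1 refl)
p231 = mkPerm (2 ∷ 3 ∷ 1 ∷ []) (trans (prep 2 (swap 3 1 refl)) (swap 2 1 refl))

⟨123,132,213,231⟩ : ReplacementPartition 3
⟨123,132,213,231⟩ = record
  { parts    = (p123 ∷ p132 ∷ p213 ∷ p231 ∷ []) ∷ []
  ; disjoint = [] ∷ []
  }

{-# OPTIONS --safe #-}
module Submission where

-- Why there are n classes.  A window may be rewritten exactly when its first
-- letter is not its largest one, and then its three letters may be rearranged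
-- in any way that keeps the largest one out of the first place.
--
-- * Invariant.  A rewritten window starts with the maximum of the word neither
--   before nor after the rewriting.  So the maximum m stays in first place if
--   it is there and never gets there otherwise; if it is there, the same
--   applies to the rest of the word with its maximum m - 1, and so on.  Hence
--   the length of the longest prefix m, m - 1, m - 2, ... is constant on
--   classes.  It is recorded by `classIndex`, see `classIndex-replacement`.
--   Replacing a window by one with the same order permutation changes nothing
--   at all, which is `order-iso-↭⇒≡`.
--
-- * Completeness.  Outside the first place m moves freely (`bubble`), and the
--   two letters preceding m may be swapped.  Carrying m to the right of two
--   neighbours, swapping them and carrying m back realises every rearrangement
--   of the other letters (`insertSecond-cong`).  So all words that do not
--   start with m are equivalent, and by induction on the length all words with
--   the same index are equivalent (`connected`).
--
-- A prefix m, m - 1, ... that misses only the last letter cannot be maximal, so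
-- the length of the prefix takes n values.  They are numbered by Fin n, and
-- `representative` attains each of them.

open import Defs

open import Data.Fin as Fin using (Fin; zero; suc; toℕ; #_)
import Data.Fin.Properties as Fin
open import Data.List using (List; []; _∷_; _++_; applyUpTo; filter; length)
open import Data.List.Membership.Propositional using (_∈_; find)
open import Data.List.Membership.Propositional.Properties using (∈-∃++)
open import Data.List.Properties using (≡-dec; length-applyUpTo; applyUpTo-∷ʳ)
open import Data.List.Relation.Binary.Permutation.Propositional
  using (_↭_; prep; swap; ↭-refl; ↭-sym; ↭-trans; ↭-reflexive; ↭⇒↭ₛ)
open import Data.List.Relation.Binary.Permutation.Propositional.Properties
  using (All-resp-↭; ∈-resp-↭; ↭-length; ↭-singleton-inv; drop-∷; filter-↭; shift; ++-comm;
         ∷↭∷ʳ)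
open _↭_ using () renaming (refl to ↭-refl′; trans to ↭-trans′)
import Data.List.Relation.Binary.Permutation.Setoid.Properties as ↭ₛ
open import Data.List.Relation.Binary.Pointwise using (Pointwise-≡⇒≡)
open import Data.List.Relation.Unary.All as All using (All; []; _∷_)
import Data.List.Relation.Unary.All.Properties as All
open import Data.List.Relation.Unary.AllPairs as AllPairs using ([]; _∷_)
open import Data.List.Relation.Unary.Any using (Any; here; there)
open import Data.List.Relation.Unary.Sorted.TotalOrder.Properties using (applyUpTo⁺₂; ↗↭↗⇒≋)
open import Data.List.Relation.Unary.Unique.Propositional using (Unique)
open import Data.List.Relation.Unary.Unique.Propositional.Properties using (applyUpTo⁺₁)
open import Data.Nat using (ℕ; zero; suc; _≤_; _<_; z≤n; s≤s; _≟_; _<?_)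
open import Data.Nat.Properties
open import Data.List.Sort ≤-decTotalOrder using (sort; sort-↭; sort-↗)
open import Data.Product using (_×_; _,_; ∃-syntax)
open import Data.Sum using (inj₁; inj₂)
open import Data.Vec using (Vec; []; _∷_; lookup; toList; fromList; cast; map)
open import Data.Vec.Membership.Propositional.Properties using (∈-lookup; ∈-toList⁺)
open import Data.Vec.Properties
  using (cast-is-id; lookup-map; tabulate∘lookup; tabulate-cong; toList-injective; toList-cast;
         toList∘fromList)
open import Function using (_∘_)
open import Function.Bundles using (_⇔_; mk⇔; Equivalence)
open import Relation.Binary.Construct.Closure.Equivalence as EqClosure using (EqClosure)
open import Relation.Binary.Construct.Closure.ReflexiveTransitive using (ε; _◅_; _◅◅_)
open import Relation.Binary.Construct.Closure.Symmetric using (SymClosure; fwd; bwd)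
open import Relation.Binary.Definitions using (tri<; tri≈; tri>)
open import Relation.Binary.PropositionalEquality
open import Relation.Nullary using (¬_; yes; no; contradiction; recompute)
open import Relation.Unary using (Decidable; _⊆_)
import Relation.Binary.Reasoning.Setoid as SetoidReasoning

open Equivalence using (to; from)

-- The words of permutations

-- The letters 1, ..., n in increasing order.
letters : ℕ → List ℕ
letters = applyUpTo suc

letters-max : ∀ n → letters (suc n) ↭ suc n ∷ letters n
letters-max n = ↭-trans (↭-reflexive (sym (applyUpTo-∷ʳ suc n)))
                        (↭-sym (∷↭∷ʳ (suc n) (letters n)))

letters-bounded : ∀ n → All (_< suc n) (letters n)
letters-bounded n = All.applyUpTo⁺₁ suc n s≤s

drop-max : ∀ n {w} → suc n ∷ w ↭ letters (suc n) → w ↭ letters n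
drop-max n p = drop-∷ (↭-trans p (letters-max n))

Unique-resp-↭ : ∀ {v w : List ℕ} → v ↭ w → Unique v → Unique w
Unique-resp-↭ p = ↭ₛ.Unique-resp-↭ (setoid ℕ) (↭⇒↭ₛ p)

module _ {n : ℕ} {w : List ℕ} (p : w ↭ letters n) where

  word-bounded : All (_< suc n) w
  word-bounded = All-resp-↭ (↭-sym p) (letters-bounded n)

  word-unique : Unique w
  word-unique = Unique-resp-↭ (↭-sym p)
    (applyUpTo⁺₁ suc n λ i<j _ → <⇒≢ i<j ∘ suc-injective)

-- Being a rearrangement of 1, ..., n is decidable, by sorting.  This makes the
-- irrelevant field `isPermutation` available in relevant positions.
word-↭ : ∀ {n} (φ : Permutation n) → toList (word φ) ↭ letters n
word-↭ {n} (mkPerm w p) = ↭-trans (↭-sym (sort-↭ (toList w))) (↭-reflexive sorted)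
  where
  sorted : sort (toList w) ≡ letters n
  sorted = recompute (≡-dec _≟_ _ _) (Pointwise-≡⇒≡
    (↗↭↗⇒≋ ≤-totalOrder (sort-↗ (toList w))
      (applyUpTo⁺₂ ≤-totalOrder suc n (λ i → n≤1+n (suc i)))
      (↭⇒↭ₛ (↭-trans (sort-↭ (toList w)) p))))

word-injective : ∀ {n} {φ ψ : Permutation n} → toList (word φ) ≡ toList (word ψ) → φ ≡ ψ
word-injective {φ = mkPerm v _} {mkPerm w _} eq
  with refl ← trans (sym (cast-is-id refl v)) (toList-injective refl v w eq) = refl

module _ {n : ℕ} (w : List ℕ) (p : w ↭ letters n) where

  private
    length-w : length w ≡ n
    length-w = trans (↭-length p) (length-applyUpTo suc n)

    toList-w : toList (cast length-w (fromList w)) ≡ w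
    toList-w = trans (toList-cast length-w (fromList w)) (toList∘fromList w)

  -- The permutation with word w.
  fromWord : Permutation n
  fromWord = mkPerm (cast length-w (fromList w)) (subst (_↭ letters n) (sym toList-w) p)

  word-fromWord : toList (word fromWord) ≡ w
  word-fromWord = toList-w

-- Order isomorphic rearrangements are equal

module _ {P Q : ℕ → Set} (P? : Decidable P) (Q? : Decidable Q) where

  count-cong : ∀ {n} (u v : Vec ℕ n) → (∀ i → P (lookup u i) ⇔ Q (lookup v i)) →
               length (filter P? (toList u)) ≡ length (filter Q? (toList v))
  count-cong []      []      _ = refl
  count-cong (x ∷ u) (y ∷ v) h with P? x | Q? y
  ... | yes _  | yes _  = cong suc (count-cong u v (h ∘ suc))
  ... | no  _  | no  _  = count-cong u v (h ∘ suc)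
  ... | yes px | no ¬qy = contradiction (to (h zero) px) ¬qy
  ... | no ¬px | yes qy = contradiction (from (h zero) qy) ¬px

  module _ (P⊆Q : P ⊆ Q) where

    count-mono-≤ : ∀ xs → length (filter P? xs) ≤ length (filter Q? xs)
    count-mono-≤ [] = z≤n
    count-mono-≤ (x ∷ xs) with P? x | Q? x
    ... | yes _  | yes _  = s≤s (count-mono-≤ xs)
    ... | no  _  | no  _  = count-mono-≤ xs
    ... | no  _  | yes _  = m≤n⇒m≤1+n (count-mono-≤ xs)
    ... | yes px | no ¬qx = contradiction (P⊆Q px) ¬qx

    count-mono-< : ∀ {a xs} → ¬ P a → Q a → a ∈ xs →
                   length (filter P? xs) < length (filter Q? xs)
    count-mono-< {xs = x ∷ xs} ¬pa qa a∈ with P? x | Q? x | a∈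
    ... | yes px | _      | here refl = contradiction px ¬pa
    ... | no  _  | no ¬qx | here refl = contradiction qa ¬qx
    ... | no  _  | yes _  | here refl = s≤s (count-mono-≤ xs)
    ... | yes _  | yes _  | there a∈′ = s≤s (count-mono-< ¬pa qa a∈′)
    ... | no  _  | no  _  | there a∈′ = count-mono-< ¬pa qa a∈′
    ... | no  _  | yes _  | there a∈′ = m≤n⇒m≤1+n (count-mono-< ¬pa qa a∈′)
    ... | yes px | no ¬qx | there _   = contradiction (P⊆Q px) ¬qx

-- The number of letters of a word that are less than a.
below : ℕ → List ℕ → ℕ
below a = length ∘ filter (_<? a)

below-↭ : ∀ a {xs ys} → xs ↭ ys → below a xs ≡ below a ys
below-↭ a p = ↭-length (filter-↭ (_<? a) p)

below-mono-< : ∀ {a b xs} → a < b → a ∈ xs → below a xs < below b xs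
below-mono-< a<b = count-mono-< (_<? _) (_<? _) (λ x<a → <-trans x<a a<b) (<-irrefl refl) a<b

-- A letter of a word is determined by the number of letters below it, and
-- this number depends on the relative order only.
order-iso-↭⇒≡ : ∀ {n} (u v : Vec ℕ n) →
                (∀ i j → lookup u i < lookup u j ⇔ lookup v i < lookup v j) →
                toList u ↭ toList v → u ≡ v
order-iso-↭⇒≡ u v iso p =
  trans (sym (tabulate∘lookup u)) (trans (tabulate-cong pointwise) (tabulate∘lookup v))
  where
  pointwise : ∀ i → lookup u i ≡ lookup v i
  pointwise i with <-cmp (lookup u i) (lookup v i)
  ... | tri≈ _ eq _ = eq
  ... | tri< u<v _ _ = contradiction (below-mono-< u<v (∈-toList⁺ (∈-lookup i u))) (<-irrefl same)
    where
    same : below (lookup u i) (toList u) ≡ below (lookup v i) (toList u)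
    same = trans (count-cong (_<? _) (_<? _) u v (λ j → iso j i)) (below-↭ (lookup v i) (↭-sym p))
  ... | tri> _ _ v<u = contradiction (below-mono-< v<u (∈-toList⁺ (∈-lookup i v))) (<-irrefl same)
    where
    same : below (lookup v i) (toList v) ≡ below (lookup u i) (toList v)
    same = trans (sym (count-cong (_<? _) (_<? _) u v (λ j → iso j i))) (below-↭ (lookup u i) p)

++-cancelˡ-↭ : ∀ (xs : List ℕ) {ys zs} → xs ++ ys ↭ xs ++ zs → ys ↭ zs
++-cancelˡ-↭ []       p = p
++-cancelˡ-↭ (x ∷ xs) p = ++-cancelˡ-↭ xs (drop-∷ p)

++-cancelʳ-↭ : ∀ (xs ys zs : List ℕ) → xs ++ zs ↭ ys ++ zs → xs ↭ ys
++-cancelʳ-↭ xs ys zs p =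
  ++-cancelˡ-↭ zs (↭-trans (++-comm zs xs) (↭-trans p (++-comm ys zs)))

-- The class index and its invariance

-- For a rearrangement w of 1, ..., suc n: the length of the longest prefix of
-- w of the form suc n, n, n - 1, ..., except that the last letter is not
-- examined: it matches whenever all the others do, so no information is lost
-- and the values are exactly those of Fin (suc n).  The value at the empty word
-- is arbitrary.
classIndex : ∀ n → List ℕ → Fin (suc n)
classIndex zero    _        = zero
classIndex (suc n) []       = zero
classIndex (suc n) (x ∷ xs) with x ≟ suc (suc n)
... | yes _ = suc (classIndex n xs)
... | no  _ = zero

-- The first letter of the word is not its maximum.
data HeadExceeded : List ℕ → Set where
  exceeded : ∀ {x xs} → Any (x <_) xs → HeadExceeded (x ∷ xs)

classIndex-headExceeded : ∀ n {w} → w ↭ letters (suc n) → HeadExceeded w →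
                          classIndex n w ≡ zero
classIndex-headExceeded zero    _ _ = refl
classIndex-headExceeded (suc n) {x ∷ xs} p (exceeded x<) with x ≟ suc (suc n)
... | no  _    = refl
... | yes refl with y , y∈ , m<y ← find x< =
  contradiction (All.lookup (word-bounded p) (there y∈)) (≤⇒≯ m<y)

-- The prefix measured by the class index never reaches into a suffix whose first
-- letter is exceeded, so such a suffix does not influence the index.
classIndex-context : ∀ n a {w w′} → a ++ w ↭ letters (suc n) → a ++ w′ ↭ letters (suc n) →
                     HeadExceeded w → HeadExceeded w′ →
                     classIndex n (a ++ w) ≡ classIndex n (a ++ w′)
classIndex-context n [] p p′ h h′ =
  trans (classIndex-headExceeded n p h) (sym (classIndex-headExceeded n p′ h′))
classIndex-context zero    (c ∷ a) _ _  _ _ = refl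
classIndex-context (suc n) (c ∷ a) p p′ h h′ with c ≟ suc (suc n)
... | yes refl = cong suc (classIndex-context n a (drop-max (suc n) p) (drop-max (suc n) p′) h h′)
... | no  _    = refl

-- The replacement partition under study.
K : ReplacementPartition 3
K = ⟨123,132,213,231⟩

-- The part of K with more than one element.
part : List (Permutation 3)
part = p123 ∷ p132 ∷ p213 ∷ p231 ∷ []

part-headExceeded : ∀ {u σ} b → IsOrderPermutation u σ → σ ∈ part → HeadExceeded (toList u ++ b)
part-headExceeded {x ∷ y ∷ z ∷ []} b iso (here refl) =
  exceeded (here (to (iso (# 0) (# 1)) (s≤s (s≤s z≤n))))
part-headExceeded {x ∷ y ∷ z ∷ []} b iso (there (here refl)) =
  exceeded (here (to (iso (# 0) (# 1)) (s≤s (s≤s z≤n))))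
part-headExceeded {x ∷ y ∷ z ∷ []} b iso (there (there (here refl))) =
  exceeded (there (here (to (iso (# 0) (# 2)) (s≤s (s≤s (s≤s z≤n))))))
part-headExceeded {x ∷ y ∷ z ∷ []} b iso (there (there (there (here refl)))) =
  exceeded (here (to (iso (# 0) (# 1)) (s≤s (s≤s (s≤s z≤n)))))

-- The class index of a permutation.
classOf : ∀ {n} → Permutation (suc n) → Fin (suc n)
classOf {n} φ = classIndex n (toList (word φ))

classIndex-replacement : ∀ {n} {φ ψ : Permutation (suc n)} → Replacement K (suc n) φ ψ →
                         classOf φ ≡ classOf ψ
classIndex-replacement {n} {φ} {ψ} (a , b , u , v , σ , τ , eq , eq′ , oσ , oτ , same)
  with pφ ← subst (_↭ letters (suc n)) eq (word-↭ φ)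
     | pψ ← subst (_↭ letters (suc n)) eq′ (word-↭ ψ)
  with same
... | inj₂ (here (σ∈ , τ∈)) rewrite eq | eq′ =
  classIndex-context n a pφ pψ (part-headExceeded b oσ σ∈) (part-headExceeded b oτ τ∈)
... | inj₁ refl = cong (classIndex n) (trans eq (trans (cong (λ w → a ++ w ++ b) u≡v) (sym eq′)))
  where
  u↭v : toList u ↭ toList v
  u↭v = ++-cancelʳ-↭ _ _ b (++-cancelˡ-↭ a (↭-trans pφ (↭-sym pψ)))

  iso : ∀ i j → lookup u i < lookup u j ⇔ lookup v i < lookup v j
  iso i j = mk⇔ (to (oτ i j) ∘ from (oσ i j)) (to (oσ i j) ∘ from (oτ i j))

  u≡v : toList u ≡ toList v
  u≡v = cong toList (order-iso-↭⇒≡ u v iso u↭v)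

-- Rewriting words

-- The window whose i-th letter is x, y or z, as the i-th entry of s is 0, 1 or 2.
window : ℕ → ℕ → ℕ → Vec (Fin 3) 3 → Vec ℕ 3
window x y z = map (lookup (x ∷ y ∷ z ∷ []))

-- The letter of a permutation that stands for p in an arrangement.
rank : Fin 3 → ℕ
rank p = suc (toℕ p)

window-order : ∀ {x y z} → x < y → y < z → ∀ s σ → word σ ≡ map rank s →
               IsOrderPermutation (window x y z s) σ
window-order {x} {y} {z} x<y y<z s (mkPerm _ _) refl i j
  rewrite lookup-map i rank s | lookup-map j rank s
        | lookup-map i (lookup (x ∷ y ∷ z ∷ [])) s | lookup-map j (lookup (x ∷ y ∷ z ∷ [])) s
  = mk⇔ (mono (lookup s i) (lookup s j) ∘ ≤-pred) (reflect (lookup s i) (lookup s j))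
  where
  letter : Fin 3 → ℕ
  letter = lookup (x ∷ y ∷ z ∷ [])

  mono : ∀ p q → p Fin.< q → letter p < letter q
  mono zero             (suc zero)       _ = x<y
  mono zero             (suc (suc zero)) _ = <-trans x<y y<z
  mono (suc zero)       (suc (suc zero)) _ = y<z
  mono (suc zero)       (suc zero)       (s≤s ())
  mono (suc (suc zero)) (suc zero)       (s≤s ())
  mono (suc (suc zero)) (suc (suc zero)) (s≤s (s≤s ()))

  reflect : ∀ p q → letter p < letter q → rank p < rank q
  reflect p q lt with Fin.<-cmp p q
  ... | tri< p<q _ _ = s≤s p<q
  ... | tri≈ _ refl _ = contradiction lt (<-irrefl refl)
  ... | tri> _ _ q<p = contradiction lt (<-asym (mono q p q<p))

infix 4 _⟶_ _≈_

-- Rewriting steps, anywhere in a word, around a letter m that exceeds its two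
-- distinct companions x and y.  Two constructors suffice to generate all the
-- rearrangements of the window in which m is not first.
data _⟶_ : List ℕ → List ℕ → Set where
  move : ∀ {x y m b} → x < m → y < m → x ≢ y → (x ∷ y ∷ m ∷ b) ⟶ (x ∷ m ∷ y ∷ b)
  flip : ∀ {x y m b} → x < m → y < m → x ≢ y → (x ∷ y ∷ m ∷ b) ⟶ (y ∷ x ∷ m ∷ b)
  skip : ∀ {c w w′} → w ⟶ w′ → (c ∷ w) ⟶ (c ∷ w′)

-- The equivalence relation on words generated by these steps.
_≈_ : List ℕ → List ℕ → Set
_≈_ = EqClosure _⟶_

⟶⇒↭ : ∀ {w w′} → w ⟶ w′ → w ↭ w′
⟶⇒↭ (move _ _ _) = prep _ (swap _ _ ↭-refl)
⟶⇒↭ (flip _ _ _) = swap _ _ ↭-refl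
⟶⇒↭ (skip r)     = prep _ (⟶⇒↭ r)

-- The condition defining `Replacement K n`, on the underlying words.
WordReplacement : List ℕ → List ℕ → Set
WordReplacement w w′ =
  ∃[ a ] ∃[ b ] ∃[ u ] ∃[ v ] ∃[ σ ] ∃[ τ ]
    w ≡ a ++ toList {n = 3} u ++ b ×
    w′ ≡ a ++ toList {n = 3} v ++ b ×
    IsOrderPermutation u σ ×
    IsOrderPermutation v τ ×
    SamePart K σ τ

⟶⇒replacement : ∀ {w w′} → w ⟶ w′ → WordReplacement w w′
⟶⇒replacement (skip {c} r)
  with a , b , u , v , σ , τ , refl , refl , rest ← ⟶⇒replacement r =
  c ∷ a , b , u , v , σ , τ , refl , refl , rest
⟶⇒replacement (move {x} {y} {m} {b} x<m y<m x≢y) with <-cmp x y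
... | tri≈ _ x≡y _ = contradiction x≡y x≢y
... | tri< x<y _ _ =
  [] , b , _ , _ , p123 , p132 , refl , refl ,
  window-order x<y y<m (# 0 ∷ # 1 ∷ # 2 ∷ []) p123 refl ,
  window-order x<y y<m (# 0 ∷ # 2 ∷ # 1 ∷ []) p132 refl ,
  inj₂ (here (here refl , there (here refl)))
... | tri> _ _ y<x =
  [] , b , _ , _ , p213 , p231 , refl , refl ,
  window-order y<x x<m (# 1 ∷ # 0 ∷ # 2 ∷ []) p213 refl ,
  window-order y<x x<m (# 1 ∷ # 2 ∷ # 0 ∷ []) p231 refl ,
  inj₂ (here (there (there (here refl)) , there (there (there (here refl)))))
⟶⇒replacement (flip {x} {y} {m} {b} x<m y<m x≢y) with <-cmp x y
... | tri≈ _ x≡y _ = contradiction x≡y x≢y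
... | tri< x<y _ _ =
  [] , b , _ , _ , p123 , p213 , refl , refl ,
  window-order x<y y<m (# 0 ∷ # 1 ∷ # 2 ∷ []) p123 refl ,
  window-order x<y y<m (# 1 ∷ # 0 ∷ # 2 ∷ []) p213 refl ,
  inj₂ (here (here refl , there (there (here refl))))
... | tri> _ _ y<x =
  [] , b , _ , _ , p213 , p123 , refl , refl ,
  window-order y<x x<m (# 1 ∷ # 0 ∷ # 2 ∷ []) p213 refl ,
  window-order y<x x<m (# 0 ∷ # 1 ∷ # 2 ∷ []) p123 refl ,
  inj₂ (here (there (there (here refl)) , here refl))

-- Every word on a chain of steps that starts at the word of a permutation is
-- itself the word of a permutation.
≈⇒K-equivalent : ∀ {n} {φ ψ : Permutation n} {w w′} →
                 toList (word φ) ≡ w → toList (word ψ) ≡ w′ →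
                 w ≈ w′ → EqClosure (Replacement K n) φ ψ
≈⇒K-equivalent {n} {φ} {ψ} eq eq′ ε
  with refl ← word-injective {φ = φ} {ψ} (trans eq (sym eq′)) = ε
≈⇒K-equivalent {n} {φ} refl eq′ (_◅_ {j = w₁} r rs) = step r ◅ ≈⇒K-equivalent χ-word eq′ rs
  where
  p : SymClosure _⟶_ (toList (word φ)) w₁ → w₁ ↭ letters n
  p (fwd r) = ↭-trans (↭-sym (⟶⇒↭ r)) (word-↭ φ)
  p (bwd r) = ↭-trans (⟶⇒↭ r) (word-↭ φ)

  χ : Permutation n
  χ = fromWord w₁ (p r)

  χ-word : toList (word χ) ≡ w₁
  χ-word = word-fromWord w₁ (p r)

  step : SymClosure _⟶_ (toList (word φ)) w₁ → SymClosure (Replacement K n) φ χ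
  step (fwd r) = fwd (⟶⇒replacement (subst (toList (word φ) ⟶_) (sym χ-word) r))
  step (bwd r) = bwd (⟶⇒replacement (subst (_⟶ toList (word φ)) (sym χ-word) r))

-- Words that do not start with their maximum

≈-return : ∀ {w w′} → w ⟶ w′ → w ≈ w′
≈-return = EqClosure.return

≈-skip : ∀ {c w w′} → w ≈ w′ → (c ∷ w) ≈ (c ∷ w′)
≈-skip = EqClosure.gmap _ skip

-- If all letters are distinct, one exceeding all others moves from any later place to the second one.
bubble : ∀ {m x} ys {zs} → All (_< m) (x ∷ ys ++ zs) → Unique (x ∷ ys ++ zs) →
         (x ∷ ys ++ m ∷ zs) ≈ (x ∷ m ∷ ys ++ zs)
bubble []       _ _ = ε
bubble {m} {x} (y ∷ ys) {zs} (x<m ∷ y<m ∷ <m) ((x≢y ∷ _) ∷ uniq) = begin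
  x ∷ y ∷ ys ++ m ∷ zs ≈⟨ ≈-skip (bubble ys (y<m ∷ <m) uniq) ⟩
  x ∷ y ∷ m ∷ ys ++ zs ≈⟨ ≈-return (move x<m y<m x≢y) ⟩
  x ∷ m ∷ y ∷ ys ++ zs ∎
  where open SetoidReasoning (EqClosure.setoid _⟶_)

-- The word w with m inserted right after its first letter; the empty word has
-- none and becomes the word m.
insertSecond : ℕ → List ℕ → List ℕ
insertSecond m []      = m ∷ []
insertSecond m (x ∷ w) = x ∷ m ∷ w

insertSecond-step : ∀ {m x} w → All (_< m) (x ∷ w) → Unique (x ∷ w) →
                    (x ∷ m ∷ w) ≈ (x ∷ insertSecond m w)
insertSecond-step []      _                 _               = ε
insertSecond-step (y ∷ w) (x<m ∷ y<m ∷ _) ((x≢y ∷ _) ∷ _) =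
  EqClosure.symmetric _⟶_ (≈-return (move x<m y<m x≢y))

-- In the presence of a letter m exceeding all others, distinct other letters
-- may be rearranged at will.
insertSecond-cong : ∀ {m w w′} → All (_< m) w → Unique w → w ↭ w′ →
                    insertSecond m w ≈ insertSecond m w′
insertSecond-cong <m u ↭-refl′ = ε
insertSecond-cong <m u (↭-trans′ p q) =
  insertSecond-cong <m u p ◅◅
  insertSecond-cong (All-resp-↭ p <m) (Unique-resp-↭ p u) q
insertSecond-cong {m} <m u p₀@(prep {w} {w′} x p) = begin
  x ∷ m ∷ w              ≈⟨ insertSecond-step w <m u ⟩
  x ∷ insertSecond m w   ≈⟨ ≈-skip (insertSecond-cong (All.tail <m) (AllPairs.tail u) p) ⟩
  x ∷ insertSecond m w′  ≈⟨ insertSecond-step w′ (All-resp-↭ p₀ <m) (Unique-resp-↭ p₀ u) ⟨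
  x ∷ m ∷ w′             ∎
  where open SetoidReasoning (EqClosure.setoid _⟶_)
insertSecond-cong {m} (x<m ∷ y<m ∷ <m) ((x≢y ∷ x≢) ∷ y≢ ∷ u) (swap {w} {w′} x y p) = begin
  x ∷ m ∷ y ∷ w             ≈⟨ ≈-return (move x<m y<m x≢y) ⟨
  x ∷ y ∷ m ∷ w             ≈⟨ ≈-return (flip x<m y<m x≢y) ⟩
  y ∷ x ∷ m ∷ w             ≈⟨ ≈-skip (insertSecond-step w (x<m ∷ <m) (x≢ ∷ u)) ⟩
  y ∷ x ∷ insertSecond m w  ≈⟨ ≈-skip (≈-skip (insertSecond-cong <m u p)) ⟩
  y ∷ x ∷ insertSecond m w′ ≈⟨ ≈-skip (insertSecond-step w′ (x<m ∷ All-resp-↭ p <m)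
                                        (Unique-resp-↭ (prep x p) (x≢ ∷ u))) ⟨
  y ∷ x ∷ m ∷ w′            ≈⟨ ≈-return (move y<m x<m (≢-sym x≢y)) ⟩
  y ∷ m ∷ x ∷ w′            ∎
  where open SetoidReasoning (EqClosure.setoid _⟶_)

-- A rearrangement of 1, ..., suc n not starting with suc n is equivalent to one
-- in which suc n comes second.
canonical : ∀ {n x xs} → x ≢ suc n → x ∷ xs ↭ letters (suc n) →
            ∃[ w ] w ↭ letters n × (x ∷ xs) ≈ insertSecond (suc n) w
canonical {n} {x} x≢m p with ∈-resp-↭ (↭-sym (↭-trans p (letters-max n))) (here refl)
... | here m≡x = contradiction (sym m≡x) x≢m
... | there m∈ with ys , zs , refl ← ∈-∃++ m∈ =
  x ∷ ys ++ zs , q , bubble ys (word-bounded q) (word-unique q)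
  where
  q : x ∷ ys ++ zs ↭ letters n
  q = drop-max n (↭-trans (↭-sym (shift (suc n) (x ∷ ys) zs)) p)

-- Words with the same class index are equivalent.
connected : ∀ n {w w′} → w ↭ letters (suc n) → w′ ↭ letters (suc n) →
            classIndex n w ≡ classIndex n w′ → w ≈ w′
connected zero p p′ _
  with refl ← ↭-singleton-inv p | refl ← ↭-singleton-inv p′ = ε
connected (suc n) {[]}    p _ _ = contradiction (↭-length p) λ ()
connected (suc n) {_ ∷ _} {[]} _ p′ _ = contradiction (↭-length p′) λ ()
connected (suc n) {x ∷ xs} {y ∷ ys} p p′ eq with x ≟ suc (suc n) | y ≟ suc (suc n)
... | yes refl | yes refl =
  ≈-skip (connected n (drop-max (suc n) p) (drop-max (suc n) p′) (Fin.suc-injective eq))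
... | no x≢m | no y≢m
  with w , q , r ← canonical x≢m p | w′ , q′ , r′ ← canonical y≢m p′ = begin
  x ∷ xs                         ≈⟨ r ⟩
  insertSecond (suc (suc n)) w   ≈⟨ insertSecond-cong (word-bounded q) (word-unique q)
                                     (↭-trans q (↭-sym q′)) ⟩
  insertSecond (suc (suc n)) w′  ≈⟨ r′ ⟨
  y ∷ ys                         ∎
  where open SetoidReasoning (EqClosure.setoid _⟶_)

-- Representatives

-- The word of index k: the k largest letters in decreasing order, followed by
-- the remaining ones in increasing order.
representative : ∀ n → Fin (suc n) → List ℕ
representative n       zero    = letters (suc n)
representative (suc n) (suc k) = suc (suc n) ∷ representative n k

representative-↭ : ∀ n k → representative n k ↭ letters (suc n)
representative-↭ n       zero    = ↭-refl
representative-↭ (suc n) (suc k) =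
  ↭-trans (prep _ (representative-↭ n k)) (↭-sym (letters-max (suc n)))

classIndex-representative : ∀ n k → classIndex n (representative n k) ≡ k
classIndex-representative zero    zero    = refl
classIndex-representative (suc n) zero    = refl
classIndex-representative (suc n) (suc k) with suc (suc n) ≟ suc (suc n)
... | yes _   = cong suc (classIndex-representative n k)
... | no  m≢m = contradiction refl m≢m

proposition2p39 : ∀ (n : ℕ) → 1 ≤ n → HasNumberOfClasses (K-equivalence ⟨123,132,213,231⟩ n) n
proposition2p39 (suc n) _ = record
  { to        = classOf
  ; from      = representativeOf
  ; to-cong   = classOf-cong
  ; from-cong = λ { refl → ε }
  ; inverse   = (λ {k} r → trans (classOf-cong r) (classOf-representativeOf k))
              , (λ {φ} k≡ → complete (trans (classOf-representativeOf _) k≡))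
  }
  where
  representativeOf : Fin (suc n) → Permutation (suc n)
  representativeOf k = fromWord (representative n k) (representative-↭ n k)

  classOf-representativeOf : ∀ k → classOf (representativeOf k) ≡ k
  classOf-representativeOf k =
    trans (cong (classIndex n) (word-fromWord (representative n k) (representative-↭ n k)))
          (classIndex-representative n k)

  classOf-cong : ∀ {φ ψ} → EqClosure (Replacement K (suc n)) φ ψ → classOf φ ≡ classOf ψ
  classOf-cong = EqClosure.gfold isEquivalence classOf
    (λ {φ} {ψ} → classIndex-replacement {φ = φ} {ψ})

  complete : ∀ {φ ψ} → classOf φ ≡ classOf ψ → EqClosure (Replacement K (suc n)) φ ψ
  complete {φ} {ψ} eq = ≈⇒K-equivalent refl refl (connected n (word-↭ φ) (word-↭ ψ) eq)
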